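{- Let $\Sigma=\{\alpha_1,\alpha_2,\dots\}$ be an infinite countable alphabet, $\upsilon\notin\Sigma$ a variable, $\vec k=(k_n)_{n\in\mathbb N}\subseteq\mathbb N$ an increasing sequence, $\vec w\in L^\infty(\Sigma,\vec k;\upsilon)$ and $r,s\in\mathbb N$. If $L(\Sigma,\vec k;\upsilon)=A_1\cup\dots\cup A_r$ and $L(\Sigma,\vec k)=C_1\cup\dots\cup C_s$, then there exist an extraction $\vec u\prec\vec w$ and $1\le i_0\le r$, $1\le j_0\le s$ such that $EV(\vec u)\subseteq A_{i_0}$ and $E(\vec u)\subseteq C_{j_0}$.
   Context: $\mathbb N=\{1,2,\dots\}$. $L(\Sigma,\vec k)$ is the set of functions $w$ from a nonempty finite $\mathrm{dom}(w)\subseteq\mathbb N$ into $\Sigma$ with $w(n)\in\{\alpha_1,\dots,\alpha_{k_n}\}$ for all $n\in\mathrm{dom}(w)$; $L(\Sigma,\vec k;\upsilon)$ is the set of functions $w$ from a nonempty finite $\mathrm{dom}(w)\subseteq\mathbb N$ into $\Sigma\cup\{\upsilon\}$ with $w(n)\in\{\upsilon,\alpha_1,\dots,\alpha_{k_n}\}$ for all $n$ and $w(n)=\upsilon$ for some $n$. $w<u$ means $\max\mathrm{dom}(w)<\min\mathrm{dom}(u)$, and then $w\star u$ is the word on $\mathrm{dom}(w)\cup\mathrm{dom}(u)$ agreeing with $w$ and $u$ on their domains. $T_0(w)=w$; for $p\in\mathbb N$, $T_p(w)$ has domain $\mathrm{dom}(w)$ and replaces each $\upsilon$ at position $n$ by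 $\alpha_p$ if $k_n\ge p$ and by $\alpha_{k_n}$ if $k_n<p$, leaving letters of $\Sigma$ unchanged. $L^\infty(\Sigma,\vec k;\upsilon)$ is the set of sequences $\vec w=(w_n)_{n\in\mathbb N}$ in $L(\Sigma,\vec k;\upsilon)$ with $w_n<w_{n+1}$ for all $n$. For such $\vec w$, $EV(\vec w)$ is the set of all words $T_{p_1}(w_{n_1})\star\cdots\star T_{p_\lambda}(w_{n_\lambda})$ with $\lambda\in\mathbb N$, $n_1<\dots<n_\lambda$, $0\le p_i\le k_{n_i}$ integers and $0\in\{p_1,\dots,p_\lambda\}$; $E(\vec w)$ is the set of such words with $1\le p_i\le k_{n_i}$ for all $i$. $\vec u\prec\vec w$ means $\vec u\in L^\infty(\Sigma,\vec k;\upsilon)$ and every term of $\vec u$ lies in $EV(\vec w)$. -}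

module Defs where

open import Data.Nat using (ℕ; zero; suc; _≤_; _<_; _≤ᵇ_)
open import Data.Bool using (if_then_else_)
open import Data.Product using (_×_; _,_; proj₁; proj₂; ∃)
open import Data.List using (List; []; _∷_; map; concatMap)
open import Data.List.Relation.Unary.All using (All)
open import Data.List.Relation.Unary.Any using (Any)
open import Data.List.Relation.Unary.Linked using (Linked)
open import Relation.Binary.PropositionalEquality using (_≡_)
open import Relation.Nullary using (¬_)
open import Data.Empty using (⊥)

-- Symbols: the variable υ, or the letter α i (standing for α_i ∈ Σ, i ≥ 1).
data Sym : Set where
  υ : Sym
  α : ℕ → Sym

-- A word is a finite list of (position , symbol) pairs; the validity
-- predicates below require strictly increasing positions (so the list is
-- the graph of a function on a finite domain ⊆ ℕ = {1,2,...}), nonempty.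
Word : Set
Word = List (ℕ × Sym)

Sorted : Word → Set
Sorted = Linked (λ x y → proj₁ x < proj₁ y)

LetterOK : (ℕ → ℕ) → ℕ × Sym → Set
LetterOK k (n , υ)   = ⊥
LetterOK k (n , α i) = 1 ≤ n × (1 ≤ i × i ≤ k n)

VarLetterOK : (ℕ → ℕ) → ℕ × Sym → Set
VarLetterOK k (n , υ)   = 1 ≤ n
VarLetterOK k (n , α i) = 1 ≤ n × (1 ≤ i × i ≤ k n)

IsWord : (ℕ → ℕ) → Word → Set
IsWord k w = ¬ (w ≡ []) × Sorted w × All (LetterOK k) w

IsVarWord : (ℕ → ℕ) → Word → Set
IsVarWord k w = ¬ (w ≡ []) × Sorted w × All (VarLetterOK k) w
                × Any (λ x → proj₂ x ≡ υ) w

-- w < u : every position of w is below every position of u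
-- (for nonempty words this is max dom(w) < min dom(u))
_<ʷ_ : Word → Word → Set
w <ʷ u = All (λ x → All (λ y → proj₁ x < proj₁ y) u) w

Tsym : (ℕ → ℕ) → ℕ → ℕ → Sym → Sym
Tsym k p n υ     = if p ≤ᵇ k n then α p else α (k n)
Tsym k p n (α i) = α i

T : (ℕ → ℕ) → ℕ → Word → Word
T k zero    w = w
T k (suc p) w = map (λ x → proj₁ x , Tsym k (suc p) (proj₁ x) (proj₂ x)) w

-- Sequences (w_n)_{n ∈ ℕ} are represented as functions ℕ → Word with
-- w i standing for w_{i+1}.
-- w ∈ L^∞(Σ,k;υ)
InfSeq : (ℕ → ℕ) → (ℕ → Word) → Set
InfSeq k w = (∀ n → IsVarWord k (w n)) × (∀ n → w n <ʷ w (suc n))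

-- A choice list [(n_1,p_1),…,(n_λ,p_λ)] (0-based indices n_i) and the word
-- T_{p_1}(w_{n_1}) ⋆ ⋯ ⋆ T_{p_λ}(w_{n_λ}) it determines.
Choice : Set
Choice = List (ℕ × ℕ)

evalChoice : (ℕ → ℕ) → (ℕ → Word) → Choice → Word
evalChoice k w ds = concatMap (λ d → T k (proj₂ d) (w (proj₁ d))) ds

IncIdx : Choice → Set
IncIdx = Linked (λ a b → proj₁ a < proj₁ b)

ValidEV : (ℕ → ℕ) → Choice → Set
ValidEV k ds = ¬ (ds ≡ []) × IncIdx ds
               × All (λ d → proj₂ d ≤ k (suc (proj₁ d))) ds
               × Any (λ d → proj₂ d ≡ 0) ds

ValidE : (ℕ → ℕ) → Choice → Set
ValidE k ds = ¬ (ds ≡ []) × IncIdx ds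
              × All (λ d → 1 ≤ proj₂ d × proj₂ d ≤ k (suc (proj₁ d))) ds

InEV : (ℕ → ℕ) → (ℕ → Word) → Word → Set
InEV k w v = ∃ λ ds → ValidEV k ds × v ≡ evalChoice k w ds

InE : (ℕ → ℕ) → (ℕ → Word) → Word → Set
InE k w v = ∃ λ ds → ValidE k ds × v ≡ evalChoice k w ds

Extraction : (ℕ → ℕ) → (ℕ → Word) → (ℕ → Word) → Set
Extraction k u w = InfSeq k u × (∀ n → InEV k w (u n))

{-# OPTIONS --safe #-}
module Submission where

-- A point is a colouring of words, with the letter 0 for the variable, and a word x acts on points
-- by (x·a)(s) = a(s ⋆ x).  For the given colouring c one looks for points f and h and arbitrarily
-- far variable words d such that, up to any finite precision, T_p(d) with p ≥ 1 takes c, f, h to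
-- f, f, h while d takes all three to h.  Choosing words d₀ < d₁ < ⋯ of this kind with increasing
-- precision, every word of E(d) gets the colour f(∅) and every word of EV(d) the colour h(∅).
--
-- In the Stone–Čech compactification such d are supplied by idempotents v ≤ q with T_p(v) = q, but
-- this uses Zorn's lemma, while excluded middle for small types only yields dependent choice.
-- Only the effect on countably many points matters, however.  Closed semigroups are therefore
-- restricted to stabilisers of sequences of points, and minimal ones replaced by ones whose orbit
-- closures of the relevant points can no longer be shrunk.  Orbit closures live in a compact
-- metrizable space, so that countably many steps suffice.

open import Defs
open import Level using (0ℓ)
open import Axiom.ExcludedMiddle using (ExcludedMiddle)
open import Data.Bool using (Bool; true; false) renaming (T to IsTrue)
open import Data.Empty using (⊥; ⊥-elim)
open import Data.Fin using (Fin; toℕ; fromℕ<; _↑ˡ_; _↑ʳ_)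
open import Data.Fin.Properties
  using (any?; toℕ<n; toℕ-injective; toℕ-fromℕ<; ↑ˡ-injective; ↑ʳ-injective)
open import Data.List using (List; []; _∷_; _++_; map; concatMap)
open import Data.List.Properties using (map-++; ++-assoc; ++-identityʳ; ++-conicalˡ; concatMap-++)
open import Data.List.Relation.Unary.All using (All; []; _∷_)
import Data.List.Relation.Unary.All as All
import Data.List.Relation.Unary.All.Properties as All
open import Data.List.Relation.Unary.Any using (Any; here; there)
import Data.List.Relation.Unary.Any.Properties as Any
open import Data.List.Relation.Unary.Linked using (Linked; []; [-]; _∷_)
import Data.List.Relation.Unary.Linked as Linked
import Data.List.Relation.Unary.Linked.Properties as Linked
open import Data.Nat using (ℕ; zero; suc; _+_; _≤_; _<_; z≤n; s≤s; _⊔_; _≤ᵇ_)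
open import Data.Nat.Properties
open import Data.Product using (Σ; _×_; ∃; _,_; proj₁; proj₂)
open import Data.Sum using (inj₁; inj₂)
open import Data.Unit using (⊤; tt)
open import Relation.Binary.PropositionalEquality
open import Relation.Nullary using (¬_; yes; no; contradiction)

-- Enumerations of countable types.

Enumeration : Set → Set
Enumeration A = Σ (ℕ → A) λ e → ∀ a → ∃ λ n → e n ≡ a

-- The walk runs along each antidiagonal from (s, 0) to (0, s) and then starts the next one.
unpair : ℕ → ℕ × ℕ
unpair zero = zero , zero
unpair (suc n) with unpair n
... | zero  , b = suc b , zero
... | suc a , b = a , suc b

-- The walk is retraced: induction on the sum of the coordinates, then on the second one.
unpair-surjective : ∀ p → ∃ λ n → unpair n ≡ p
unpair-surjective (a , b) = diagonal (a + b) b a refl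
  where
  diagonal : ∀ s b a → a + b ≡ s → ∃ λ n → unpair n ≡ (a , b)
  diagonal s (suc b) a eq with diagonal s b (suc a) (trans (sym (+-suc a b)) eq)
  ... | n , q = suc n , step
    where
    step : unpair (suc n) ≡ (a , suc b)
    step rewrite q = refl
  diagonal zero    zero zero    eq = 0 , refl
  diagonal (suc s) zero (suc a) eq
    with diagonal s a zero (suc-injective (trans (cong suc (sym (+-identityʳ a))) eq))
  ... | n , q = suc n , step
    where
    step : unpair (suc n) ≡ (suc a , 0)
    step rewrite q = refl

opaque
  ℕ×ℕ-enumeration : Enumeration (ℕ × ℕ)
  ℕ×ℕ-enumeration = unpair , unpair-surjective

  _×-enumeration_ : ∀ {A B} → Enumeration A → Enumeration B → Enumeration (A × B)
  _×-enumeration_ {A} {B} (e , e-surj) (f , f-surj) = g , g-surj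
    where
    g : ℕ → A × B
    g n = e (proj₁ (unpair n)) , f (proj₂ (unpair n))
    g-surj : ∀ p → ∃ λ n → g n ≡ p
    g-surj (a , b) with e-surj a | f-surj b
    ... | i , refl | j , refl with unpair-surjective (i , j)
    ... | n , q = n , cong (λ p → e (proj₁ p) , f (proj₂ p)) q

  List-enumeration : ∀ {A} → Enumeration A → Enumeration (List A)
  List-enumeration {A} (e , e-surj) =
    (λ n → decode (proj₁ (unpair n)) (proj₂ (unpair n))) , surj
    where
    decode : ℕ → ℕ → List A
    decode zero    n = []
    decode (suc l) n = e (proj₁ (unpair n)) ∷ decode l (proj₂ (unpair n))
    code : ∀ xs → ∃ λ l → ∃ λ n → decode l n ≡ xs
    code [] = 0 , 0 , refl
    code (x ∷ xs) with e-surj x | code xs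
    ... | i , refl | l , n , refl with unpair-surjective (i , n)
    ... | m , q = suc l , m , cong (λ p → e (proj₁ p) ∷ decode l (proj₂ p)) q
    surj : ∀ xs → ∃ λ n → decode (proj₁ (unpair n)) (proj₂ (unpair n)) ≡ xs
    surj xs with code xs
    ... | l , n , refl with unpair-surjective (l , n)
    ... | m , q = m , cong (λ p → decode (proj₁ p) (proj₂ p)) q

-- Bounds for finitely many numbers.

sup : (ℕ → ℕ) → ℕ → ℕ
sup f zero    = zero
sup f (suc n) = f n ⊔ sup f n

≤-sup : ∀ f {j n} → j < n → f j ≤ sup f n
≤-sup f {j} {suc n} (s≤s j≤n) with m≤n⇒m<n∨m≡n j≤n
... | inj₁ j<n  = ≤-trans (≤-sup f j<n) (m≤n⊔m (f n) (sup f n))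
... | inj₂ refl = m≤m⊔n (f n) (sup f n)

opaque
  bounded-witnesses : ∀ {P : ℕ → ℕ → Set} i → (∀ j → j < i → ∃ (P j)) →
                      ∃ λ N → ∀ j → j < i → ∃ λ j′ → j′ < N × P j j′
  bounded-witnesses zero w = 0 , λ j ()
  bounded-witnesses {P} (suc i) w
    with bounded-witnesses {P} i (λ j j<i → w j (m<n⇒m<1+n j<i)) | w i ≤-refl
  ... | N , h | j₀ , p = suc j₀ ⊔ N , go
    where
    go : ∀ j → j < suc i → ∃ λ j′ → j′ < suc j₀ ⊔ N × P j j′
    go j (s≤s j≤i) with m≤n⇒m<n∨m≡n j≤i
    ... | inj₂ refl = j₀ , m≤m⊔n (suc j₀) N , p
    ... | inj₁ j<i with h j j<i
    ... | j′ , lt , q = j′ , ≤-trans lt (m≤n⊔m (suc j₀) N) , q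

-- Dependent choice and the infinite pigeonhole principle.

module Classical (lem : ExcludedMiddle 0ℓ) where

  opaque
    -- The ordering principle of Brezis and Browder: dependent choice takes the place of Zorn's
    -- lemma, as stability is required for countably many properties only.
    exists-stable : {Q I : Set} → Enumeration I → (_≼_ : Q → Q → Set) →
      (∀ {s} → s ≼ s) → (∀ {s t u} → s ≼ t → t ≼ u → s ≼ u) →
      ((s : ℕ → Q) → (∀ {m n} → m ≤ n → s n ≼ s m) → ∃ λ t → ∀ n → t ≼ s n) →
      (Φ : Q → I → Set) → (∀ {s t i} → s ≼ t → Φ s i → Φ t i) →
      ∀ s → ∃ λ t → t ≼ s × (∀ {u} → u ≼ t → ∀ i → Φ t i → Φ u i)
    exists-stable {Q} {I} (e , e-surj) _≼_ refl≼ trans≼ lower Φ antitone s₀ =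
      t , t≼ 0 , stable
      where
      -- If some state below s fails property i, it is chosen at once; otherwise the property holds
      -- everywhere below s. Either way the returned implication is true.
      refine : ∀ i s → ∃ λ t → t ≼ s × (Φ t i → ∀ {u} → u ≼ s → Φ u i)
      refine i s with lem {∃ λ u → u ≼ s × ¬ Φ u i}
      ... | yes (u , u≼s , ¬Φ) = u , u≼s , λ Φu → contradiction Φu ¬Φ
      ... | no none = s , refl≼ , λ _ {u} u≼s → decide u u≼s
        where
        decide : ∀ u → u ≼ s → Φ u i
        decide u u≼s with lem {Φ u i}
        ... | yes p = p
        ... | no ¬p = contradiction (u , u≼s , ¬p) none
      chain : ℕ → Q
      chain zero    = s₀
      chain (suc n) = proj₁ (refine (e n) (chain n))
      decreasing : ∀ {m n} → m ≤ n → chain n ≼ chain m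
      decreasing {m} {zero}  z≤n = refl≼
      decreasing {m} {suc n} m≤n with m≤n⇒m<n∨m≡n m≤n
      ... | inj₂ refl      = refl≼
      ... | inj₁ (s≤s lt) =
        trans≼ (proj₁ (proj₂ (refine (e n) (chain n)))) (decreasing lt)
      t : Q
      t = proj₁ (lower chain decreasing)
      t≼ : ∀ n → t ≼ chain n
      t≼ = proj₂ (lower chain decreasing)
      stable : ∀ {u} → u ≼ t → ∀ i → Φ t i → Φ u i
      stable {u} u≼t i Φt with e-surj i
      ... | n , refl = proj₂ (proj₂ (refine (e n) (chain n)))
                         (antitone (t≼ (suc n)) Φt) (trans≼ u≼t (t≼ n))

  Frequent : (ℕ → Set) → Set
  Frequent φ = ∀ i → ∃ λ j → i ≤ j × φ j

  opaque
    -- Otherwise each of the finitely many colours stops occurring on φ at some stage, and past a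
    -- common bound φ itself would fail.
    frequent-colour : ∀ {R φ} → Frequent φ → (col : ℕ → Fin R) →
                      ∃ λ v → Frequent (λ j → φ j × col j ≡ v)
    frequent-colour {R} {φ} freq col
      with any? (λ v → lem {Frequent (λ j → φ j × col j ≡ v)})
    ... | yes p = p
    ... | no none = ⊥-elim absurd
      where
      avoid : ∀ v → ∃ λ N → ∀ j → N ≤ j → φ j → ¬ (col j ≡ v)
      avoid v with lem {∃ λ N → ∀ j → N ≤ j → φ j → ¬ (col j ≡ v)}
      ... | yes p = p
      ... | no q = ⊥-elim (none (v , λ i → later i))
        where
        later : ∀ i → ∃ λ j → i ≤ j × φ j × col j ≡ v
        later i with lem {∃ λ j → i ≤ j × φ j × col j ≡ v}
        ... | yes p = p
        ... | no r = ⊥-elim (q (i , λ j i≤j φj eq → r (j , i≤j , φj , eq)))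
      P : ℕ → ℕ → Set
      P v N = ∀ j → N ≤ j → φ j → ¬ (toℕ (col j) ≡ v)
      bound : ∃ λ N → ∀ v → v < R → ∃ λ N′ → N′ < N × P v N′
      bound = bounded-witnesses {P} R λ v v<R →
        proj₁ (avoid (fromℕ< v<R)) ,
        λ j N≤j φj eq → proj₂ (avoid (fromℕ< v<R)) j N≤j φj
          (toℕ-injective (trans eq (sym (toℕ-fromℕ< v<R))))
      absurd : ⊥
      absurd with freq (proj₁ bound)
      ... | j , N≤j , φj with proj₂ bound (toℕ (col j)) (toℕ<n (col j))
      ... | N′ , N′<N , avoids = avoids j (≤-trans (<⇒≤ N′<N) N≤j) φj refl

-- Substitution in choice lists.

fill : ℕ → ℕ → ℕ
fill p zero    = p
fill p (suc q) = suc q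

-- T_p on choice lists, in which the letter 0 stands for the variable.
sub : ℕ → Choice → Choice
sub p = map (λ d → proj₁ d , fill p (proj₂ d))

Constant : Choice → Set
Constant = All (λ d → 1 ≤ proj₂ d)

Variable : Choice → Set
Variable = Any (λ d → proj₂ d ≡ 0)

Arbitrary : Choice → Set
Arbitrary _ = ⊤

fill-fill : ∀ {p} q → 1 ≤ p → ∀ l → fill q (fill p l) ≡ fill p l
fill-fill q (s≤s _) zero    = refl
fill-fill q _       (suc l) = refl

sub-sub : ∀ {p} q → 1 ≤ p → ∀ x → sub q (sub p x) ≡ sub p x
sub-sub q 1≤p []            = refl
sub-sub q 1≤p ((n , l) ∷ x) = cong₂ _∷_ (cong (n ,_) (fill-fill q 1≤p l)) (sub-sub q 1≤p x)

sub-zero : ∀ x → sub 0 x ≡ x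
sub-zero []                = refl
sub-zero ((n , zero) ∷ x)  = cong (_ ∷_) (sub-zero x)
sub-zero ((n , suc l) ∷ x) = cong (_ ∷_) (sub-zero x)

sub-constant : ∀ {p x} → Constant x → sub p x ≡ x
sub-constant []                                = refl
sub-constant {x = (n , suc l) ∷ x} (s≤s _ ∷ c) = cong (_ ∷_) (sub-constant c)

constant-sub : ∀ {p} → 1 ≤ p → ∀ x → Constant (sub p x)
constant-sub 1≤p []                = []
constant-sub 1≤p ((n , zero) ∷ x)  = 1≤p ∷ constant-sub 1≤p x
constant-sub 1≤p ((n , suc l) ∷ x) = s≤s z≤n ∷ constant-sub 1≤p x

increasing-sub : ∀ p {x} → IncIdx x → IncIdx (sub p x)
increasing-sub p inc = Linked.map⁺ inc

end : Choice → ℕ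
end []      = 0
end (d ∷ x) = suc (proj₁ d) ⊔ end x

<-end : ∀ x {N} → end x ≤ N → All (λ d → proj₁ d < N) x
<-end [] _ = []
<-end (d ∷ x) le = ≤-trans (m≤m⊔n (suc (proj₁ d)) (end x)) le ∷
                   <-end x (≤-trans (m≤n⊔m (suc (proj₁ d)) (end x)) le)

-- Composition of choice lists: a choice among the words described by the `d n` becomes a choice
-- among the original words.
expand : (ℕ → Choice) → Choice → Choice
expand d = concatMap (λ e → sub (proj₂ e) (d (proj₁ e)))

linked-++ : ∀ {A : Set} {_<′_ : A → A → Set} {xs ys} → Linked _<′_ xs → Linked _<′_ ys →
            All (λ x → All (x <′_) ys) xs → Linked _<′_ (xs ++ ys)
linked-++ [] lys _ = lys
linked-++ [-] [] _ = [-]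
linked-++ [-] [-] ((lt ∷ _) ∷ _) = lt ∷ [-]
linked-++ [-] (lt′ ∷ lys) ((lt ∷ _) ∷ _) = lt ∷ lt′ ∷ lys
linked-++ (lt ∷ lxs) lys (_ ∷ lts) = lt ∷ linked-++ lxs lys lts

-- The compact space of colourings and the action of words.

module Dynamics (lem : ExcludedMiddle 0ℓ) (κ : ℕ → ℕ) (1≤κ : ∀ n → 1 ≤ κ n)
                (κ-mono : ∀ {m n} → m ≤ n → κ m ≤ κ n) (R : ℕ) where

  open Classical lem

  Point : Set
  Point = Choice → Fin R

  Choice-enumeration : Enumeration Choice
  Choice-enumeration = List-enumeration ℕ×ℕ-enumeration

  opaque
    word : ℕ → Choice
    word = proj₁ Choice-enumeration

    index : Choice → ℕ
    index s = proj₁ (proj₂ Choice-enumeration s)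

    word-index : ∀ s → word (index s) ≡ s
    word-index s = proj₂ (proj₂ Choice-enumeration s)

  infix 4 _≈[_]_
  -- Basic entourages of the product topology, which is metrizable because words are enumerated.
  record _≈[_]_ (a : Point) (i : ℕ) (b : Point) : Set where
    constructor agree
    field at : ∀ n → n < i → a (word n) ≡ b (word n)
  open _≈[_]_ public

  ≈-refl : ∀ {a i} → a ≈[ i ] a
  ≈-refl = agree λ _ _ → refl

  ≈-sym : ∀ {a b i} → a ≈[ i ] b → b ≈[ i ] a
  ≈-sym p = agree λ n n<i → sym (at p n n<i)

  ≈-trans : ∀ {a b c i} → a ≈[ i ] b → b ≈[ i ] c → a ≈[ i ] c
  ≈-trans p q = agree λ n n<i → trans (at p n n<i) (at q n n<i)

  ≈-mono : ∀ {a b i j} → i ≤ j → a ≈[ j ] b → a ≈[ i ] b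
  ≈-mono i≤j p = agree λ n n<i → at p n (≤-trans n<i i≤j)

  ≈-at : ∀ {a b i} s → index s < i → a ≈[ i ] b → a s ≡ b s
  ≈-at {a} {b} s lt p = subst (λ s → a s ≡ b s) (word-index s) (at p (index s) lt)

  opaque
    act : Choice → Point → Point
    act x a s = a (s ++ x)

    act-apply : ∀ x a s → act x a s ≡ a (s ++ x)
    act-apply x a s = refl

    act-++ : ∀ x y a {i} → act (x ++ y) a ≈[ i ] act x (act y a)
    act-++ x y a = agree λ n _ → cong a (sym (++-assoc (word n) x y))

    act-[] : ∀ a {i} → act [] a ≈[ i ] a
    act-[] a = agree λ n _ → cong a (++-identityʳ (word n))

    -- At `word n`, the point `act x a` reads `a` at `word n ++ x`; all these words for n < i have
    -- to be covered.
    modulusOfContinuity : ℕ → Choice → ℕ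
    modulusOfContinuity i x = sup (λ n → suc (index (word n ++ x))) i

    act-continuous : ∀ i x {a b} → a ≈[ modulusOfContinuity i x ] b → act x a ≈[ i ] act x b
    act-continuous i x p =
      agree λ n n<i → ≈-at (word n ++ x) (≤-sup (λ n → suc (index (word n ++ x))) n<i) p

  opaque
    -- Sequential compactness by diagonalisation: the value at each word in turn is fixed so that
    -- infinitely many indices survive.
    cluster : (b : ℕ → Point) → ∃ λ β → ∀ i → ∃ λ j → i ≤ j × b j ≈[ i ] β
    cluster b = β , near
      where
      trace : ℕ → Σ (ℕ → Set) Frequent
      colour : ∀ n → ∃ λ v → Frequent (λ j → proj₁ (trace n) j × b j (word n) ≡ v)
      trace zero    = (λ _ → ⊤) , λ i → i , ≤-refl , tt
      trace (suc n) = _ , proj₂ (colour n)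
      colour n = frequent-colour (proj₂ (trace n)) (λ j → b j (word n))
      β : Point
      β s = proj₁ (colour (index s))
      agrees : ∀ N {j} → proj₁ (trace N) j → ∀ n → n < N → b j (word n) ≡ proj₁ (colour n)
      agrees (suc N) (tr , eq) n (s≤s n≤N) with m≤n⇒m<n∨m≡n n≤N
      ... | inj₁ n<N  = agrees N tr n n<N
      ... | inj₂ refl = eq
      near : ∀ i → ∃ λ j → i ≤ j × b j ≈[ i ] β
      -- `β` looks words up by `index`, and `index (word n)` may differ from n, so the trace must
      -- pass all these indices.
      near i with proj₂ (trace (sup (λ n → suc (index (word n))) i)) i
      ... | j , i≤j , tr = j , i≤j , agree λ n n<i →
        trans (cong (b j) (sym (word-index (word n))))
              (agrees _ tr (index (word n)) (≤-sup (λ n → suc (index (word n))) n<i))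

  -- Systems of fixed points and their semigroups.

  -- A system (h₀ , f₀) , (h₁ , f₁) , … stands for the closed semigroup of those limits x of words
  -- for which every T_p(x) with p ≥ 1 fixes all hⱼ, and x itself fixes the hⱼ flagged by fⱼ.
  System : Set
  System = ℕ → Point × Bool

  infixr 5 _◂_
  _◂_ : Point × Bool → System → System
  (h ◂ H) zero    = h
  (h ◂ H) (suc j) = H j

  Beyond : ℕ → Choice → Set
  Beyond i x = IncIdx x × All (λ d → i ≤ proj₁ d × proj₂ d ≤ κ (proj₁ d)) x

  -- Stage i of membership in that semigroup: indices start at i, and only i points, the letters up
  -- to `κ i` and precision i are tested. The letter 0 leaves x unchanged, so it alone depends on
  -- the flag.
  record Fixes (H : System) (i : ℕ) (x : Choice) : Set where
    constructor fixes
    field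
      beyond : Beyond i x
      fixed  : ∀ p → p ≤ κ i → ∀ j → j < i → (p ≡ 0 → proj₂ (H j) ≡ true) →
               act (sub p x) (proj₁ (H j)) ≈[ i ] proj₁ (H j)
  open Fixes public

  fixes-mono : ∀ {H i j x} → i ≤ j → Fixes H j x → Fixes H i x
  fixes-mono i≤j (fixes (inc , ok) fx) = fixes
    (inc , All.map (λ (j≤n , l) → ≤-trans i≤j j≤n , l) ok)
    λ p p≤ j j<i flag → ≈-mono i≤j (fx p (≤-trans p≤ (κ-mono i≤j)) j (≤-trans j<i i≤j) flag)

  fixes-[] : ∀ {H i} → Fixes H i []
  fixes-[] = fixes ([] , []) λ p _ j _ _ → act-[] _

  -- After `sub p` no variable is left, so the condition on x at the letter p settles all letters q.
  fixes-sub : ∀ {H i p x} → 1 ≤ p → p ≤ κ i → Fixes H i x → Fixes H i (sub p x)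
  fixes-sub {H} {i} {p} {x} 1≤p p≤ (fixes (inc , ok) fx) = fixes
    (increasing-sub p inc , All.map⁺ (All.map letter ok))
    λ q q≤ j j<i _ → subst (λ y → act y (proj₁ (H j)) ≈[ i ] proj₁ (H j)) (sym (sub-sub q 1≤p x))
      (fx p p≤ j j<i λ { refl → contradiction 1≤p λ () })
    where
    letter : ∀ {d} → i ≤ proj₁ d × proj₂ d ≤ κ (proj₁ d) →
             i ≤ proj₁ d × fill p (proj₂ d) ≤ κ (proj₁ d)
    letter {n , zero}  (i≤n , _)  = i≤n , ≤-trans p≤ (κ-mono i≤n)
    letter {n , suc l} (i≤n , ok) = i≤n , ok

  fixes-constant : ∀ {H i x} → Fixes H i x → Constant x → ∀ j → j < i →
                   act x (proj₁ (H j)) ≈[ i ] proj₁ (H j)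
  fixes-constant {H} {i} fx c j j<i =
    subst (λ y → act y (proj₁ (H j)) ≈[ i ] proj₁ (H j)) (sub-constant c)
      (fixed fx 1 (1≤κ i) j j<i λ ())

  opaque
    -- The precision at which a word must be chosen in order to be appended to x at precision i.
    modulus : ℕ → Choice → ℕ
    modulus i x = (i ⊔ end x) ⊔ (modulusOfContinuity i x ⊔
                  sup (λ p → modulusOfContinuity i (sub p x)) (suc (κ i)))

    i≤modulus : ∀ i x → i ≤ modulus i x
    i≤modulus i x = m≤n⇒m≤n⊔o _ (m≤m⊔n i (end x))

    end≤modulus : ∀ i x → end x ≤ modulus i x
    end≤modulus i x = m≤n⇒m≤n⊔o _ (m≤n⊔m i (end x))

    continuity≤modulus : ∀ i x → modulusOfContinuity i x ≤ modulus i x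
    continuity≤modulus i x = m≤n⇒m≤o⊔n (i ⊔ end x) (m≤m⊔n (modulusOfContinuity i x) _)

    continuity-sub≤modulus : ∀ i x {p} → p ≤ κ i →
                             modulusOfContinuity i (sub p x) ≤ modulus i x
    continuity-sub≤modulus i x p≤ = m≤n⇒m≤o⊔n (i ⊔ end x)
      (m≤n⇒m≤o⊔n (modulusOfContinuity i x)
        (≤-sup (λ p → modulusOfContinuity i (sub p x)) (s≤s p≤)))

  append-near : ∀ i x y a {b} → act y a ≈[ modulus i x ] b → act (x ++ y) a ≈[ i ] act x b
  append-near i x y a p =
    ≈-trans (act-++ x y a) (act-continuous i x (≈-mono (continuity≤modulus i x) p))

  append-sub-near : ∀ i x {p} y a {b} → p ≤ κ i → act (sub p y) a ≈[ modulus i x ] b →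
                    act (sub p (x ++ y)) a ≈[ i ] act (sub p x) b
  append-sub-near i x {p} y a {b} p≤ q =
    subst (λ z → act z a ≈[ i ] act (sub p x) b)
      (sym (map-++ (λ d → proj₁ d , fill p (proj₂ d)) x y))
      (≈-trans (act-++ (sub p x) (sub p y) a)
        (act-continuous i (sub p x) (≈-mono (continuity-sub≤modulus i x p≤) q)))

  -- Closure under products: y acts first, and is chosen after x, finely enough for the continuity
  -- of x to carry its error.
  fixes-++ : ∀ i x {H y} → Fixes H i x → Fixes H (modulus i x) y → Fixes H i (x ++ y)
  fixes-++ i x {H} {y} (fixes (incx , okx) fx) fy = fixes
    (linked-++ incx (proj₁ (beyond fy)) (All.map (λ d<m → All.map (λ (m≤ , _) → ≤-trans d<m m≤)
      (proj₂ (beyond fy))) (<-end x (end≤modulus i x))) ,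
     All.++⁺ okx (proj₂ (beyond (fixes-mono (i≤modulus i x) fy))))
    λ p p≤ j j<i flag → ≈-trans
      (append-sub-near i x y (proj₁ (H j)) p≤
        (fixed fy p (≤-trans p≤ (κ-mono (i≤modulus i x))) j (≤-trans j<i (i≤modulus i x)) flag))
      (fx p p≤ j j<i flag)

  infix 4 _⊆_
  -- The order is reversed for semigroups: a larger system has a smaller stabiliser.
  _⊆_ : System → System → Set
  H ⊆ H′ = ∀ j → ∃ λ j′ → H′ j′ ≡ H j

  -- Stage i involves only the first i entries of `H`, which all occur in an initial segment of
  -- `H′`.
  fixes-from : ∀ {H H′} i → (∀ j → j < i → ∃ λ j′ → H′ j′ ≡ H j) →
               ∃ λ i′ → i ≤ i′ × (∀ {x} → Fixes H′ i′ x → Fixes H i x)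
  fixes-from {H} {H′} i sub⊆ with bounded-witnesses {λ j j′ → H′ j′ ≡ H j} i sub⊆
  ... | N , w = i ⊔ N , m≤m⊔n i N , λ {x} f′ → fixes
    (beyond (fixes-mono (m≤m⊔n i N) f′))
    λ p p≤ j j<i flag → use x f′ p p≤ j j<i flag (w j j<i)
    where
    use : ∀ x → Fixes H′ (i ⊔ N) x → ∀ p → p ≤ κ i → ∀ j → j < i →
          (p ≡ 0 → proj₂ (H j) ≡ true) → (∃ λ j′ → j′ < N × H′ j′ ≡ H j) →
          act (sub p x) (proj₁ (H j)) ≈[ i ] proj₁ (H j)
    use x f′ p p≤ j j<i flag (j′ , j′<N , eq) =
      subst (λ h → act (sub p x) (proj₁ h) ≈[ i ] proj₁ h) eq
        (≈-mono (m≤m⊔n i N) (fixed f′ p (≤-trans p≤ (κ-mono (m≤m⊔n i N))) j′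
          (≤-trans j′<N (m≤n⊔m i N)) (λ p≡0 → trans (cong proj₂ eq) (flag p≡0))))

  fixes-⊆ : ∀ {H H′} → H ⊆ H′ → ∀ i → ∃ λ i′ → i ≤ i′ × (∀ {x} → Fixes H′ i′ x → Fixes H i x)
  fixes-⊆ H⊆ i = fixes-from i λ j _ → H⊆ j

  ⊆-refl : ∀ {H} → H ⊆ H
  ⊆-refl j = j , refl

  ⊆-trans : ∀ {H H′ H″} → H ⊆ H′ → H′ ⊆ H″ → H ⊆ H″
  ⊆-trans p q j with p j
  ... | j′ , eq with q j′
  ... | j″ , eq′ = j″ , trans eq′ eq

  ⊆-◂ : ∀ {H h} → H ⊆ h ◂ H
  ⊆-◂ j = suc j , refl

  -- Reachability.

  -- The limits of words of kind P in the semigroup of H take a to b.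
  record Reach (P : Choice → Set) (H : System) (a b : Point) : Set where
    constructor reach
    field reaching : ∀ i → ∃ λ x → Fixes H i x × P x × act x a ≈[ i ] b
  open Reach public

  -- By compactness, this says that the semigroup contains a limit of variable words.
  Consistent : System → Set
  Consistent H = ∀ i → ∃ λ x → Fixes H i x × Variable x

  -- The word of the second move stands on the left and is chosen first, since it decides how
  -- precise the first move must be.
  reach-trans : ∀ {P Q S : Choice → Set} → (∀ {x y} → P x → Q y → S (x ++ y)) →
                ∀ {H a b c} → Reach Q H a b → Reach P H b c → Reach S H a c
  reach-trans PQ⇒S ab bc = reach λ i →
    let x , fx , px , near-x = reaching bc i
        y , fy , qy , near-y = reaching ab (modulus i x)
    in x ++ y , fixes-++ i x fx fy , PQ⇒S px qy , ≈-trans (append-near i x y _ near-y) near-x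

  reach-⊆ : ∀ {P H H′ a b} → H ⊆ H′ → Reach P H′ a b → Reach P H a b
  reach-⊆ H⊆ r = reach λ i →
    let i′ , i≤i′ , f = fixes-⊆ H⊆ i
        x , fx , px , near = reaching r i′
    in x , f fx , px , ≈-mono i≤i′ near

  reach-weaken : ∀ {P Q H a b} → (∀ {x} → P x → Q x) → Reach P H a b → Reach Q H a b
  reach-weaken P⇒Q r = reach λ i →
    let x , fx , px , near = reaching r i in x , fx , P⇒Q px , near

  reach-refl : ∀ {P H a} → P [] → Reach P H a a
  reach-refl p[] = reach λ i → [] , fixes-[] , p[] , act-[] _

  reach-closed : ∀ {P H a b} → (∀ i → ∃ λ b′ → b′ ≈[ i ] b × Reach P H a b′) → Reach P H a b
  reach-closed lim = reach λ i →
    let b′ , near , r = lim i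
        x , fx , px , near′ = reaching r i
    in x , fx , px , ≈-trans near′ near

  reach-variable : ∀ {H} → Consistent H → ∀ a → ∃ λ b → Reach Variable H a b
  reach-variable {H} con a = proj₁ limit , reach λ i →
    let j , i≤j , near = proj₂ limit i
        x , fx , vx = con j
    in x , fixes-mono i≤j fx , vx , near
    where
    limit = cluster (λ i → act (proj₁ (con i)) a)

  constant-++ : ∀ {x y} → Constant x → Constant y → Constant (x ++ y)
  constant-++ = All.++⁺

  variable-++ˡ : ∀ {Q : Choice → Set} {x y} → Variable x → Q y → Variable (x ++ y)
  variable-++ˡ v _ = Any.++⁺ˡ v

  variable-++ʳ : ∀ {Q : Choice → Set} {x y} → Q x → Variable y → Variable (x ++ y)
  variable-++ʳ {x = x} _ v = Any.++⁺ʳ x v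

  module _ (S : ℕ → System) (increasing : ∀ {m n} → m ≤ n → S m ⊆ S n) where

    union : System
    union n = S (proj₁ (unpair n)) (proj₂ (unpair n))

    ⊆-union : ∀ n → S n ⊆ union
    ⊆-union n j with unpair-surjective (n , j)
    ... | m , eq = m , cong (λ p → S (proj₁ p) (proj₂ p)) eq

    -- Consistency has finite character: the first i entries of the union already occur in one
    -- member of the chain.
    union-consistent : (∀ n → Consistent (S n)) → Consistent union
    union-consistent con i
      with fixes-from {union} {S (sup (λ n → proj₁ (unpair n)) i)} i
             (λ n n<i → increasing (≤-sup (λ n → proj₁ (unpair n)) n<i) (proj₂ (unpair n)))
    ... | i′ , _ , f with con (sup (λ n → proj₁ (unpair n)) i) i′
    ... | x , fx , vx = x , f fx , vx

  -- Shrinking orbit closures.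

  record State : Set where
    constructor state
    field
      system     : System
      consistent : Consistent system
      point      : Point
  open State

  -- A descent enlarges the system and moves the point by words of kind `D`; the set of points
  -- reachable by words of kind `P` is what is to be minimised.
  module Descent (D P : Choice → Set) (D[] : D []) (D++ : ∀ {x y} → D x → D y → D (x ++ y))
                 (PD : ∀ {x y} → P x → D y → P (x ++ y)) (h : Point) where

    infix 4 _≼_
    _≼_ : State → State → Set
    s ≼ t = system t ⊆ system s × Reach D (system t) (point t) (point s)

    ≼-refl : ∀ {s} → s ≼ s
    ≼-refl = ⊆-refl , reach-refl D[]

    ≼-trans : ∀ {s t u} → s ≼ t → t ≼ u → s ≼ u
    ≼-trans (t⊆s , ts) (u⊆t , ut) = ⊆-trans u⊆t t⊆s , reach-trans D++ ut (reach-⊆ u⊆t ts)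

    -- A cluster point of the points works with the union of the systems: stage n reaches all later
    -- points, and reachability is closed.
    lower-bound : (s : ℕ → State) → (∀ {m n} → m ≤ n → s n ≼ s m) → ∃ λ t → ∀ n → t ≼ s n
    lower-bound s dec with cluster (λ n → point (s n))
    ... | g , lim =
      state (union S inc) (union-consistent S inc (λ n → consistent (s n))) g ,
      λ n → ⊆-union S inc n , reach-closed (λ i → approach n i (lim (n ⊔ i)))
      where
      S = λ n → system (s n)
      inc : ∀ {m n} → m ≤ n → S m ⊆ S n
      inc m≤n = proj₁ (dec m≤n)
      approach : ∀ n i → (∃ λ j → n ⊔ i ≤ j × point (s j) ≈[ n ⊔ i ] g) →
                 ∃ λ b → b ≈[ i ] g × Reach D (S n) (point (s n)) b
      approach n i (j , le , near) = point (s j) , ≈-mono (m≤n⊔m n i) near ,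
        proj₂ (dec (≤-trans (m≤m⊔n n i) le))

    -- The points reachable from a state lie in the closure of the orbit of h, so the countably
    -- many neighbourhoods of the points of that orbit distinguish the sets of reachable points.
    Meets : State → Choice × ℕ → Set
    Meets s (m , i) =
      ∀ j → ∃ λ x → Fixes (system s) j x × P x × act x (point s) ≈[ i ] act m h

    meets-antitone : ∀ {s t i} → s ≼ t → Meets s i → Meets t i
    meets-antitone {s} {t} {m , i} (t⊆s , ts) meets j with fixes-⊆ t⊆s (j ⊔ i)
    ... | i′ , _ , f with meets i′
    ... | x , fx , px , near with reaching ts (modulus (j ⊔ i) x)
    ... | y , fy , dy , near′ = x ++ y ,
      fixes-mono (m≤m⊔n j i) (fixes-++ (j ⊔ i) x (f fx) fy) , PD px dy ,
      ≈-trans (≈-mono (m≤n⊔m j i) (append-near (j ⊔ i) x y (point t) near′)) near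

    opaque
      -- Along a descent the set of `P`-reachable points can only shrink; once no neighbourhood in
      -- the list can be lost, it stays constant.
      descend : ∀ {H} → Consistent H →
        ∃ λ H′ → ∃ λ h′ → H ⊆ H′ × Consistent H′ × Reach D H h h′ ×
          (∀ {H″ h″} → H′ ⊆ H″ → Consistent H″ → Reach D H′ h′ h″ →
           ∀ {g} → Reach P H′ h′ g → Reach P H″ h″ g)
      descend {H} con
        with exists-stable (Choice-enumeration ×-enumeration ((λ n → n) , λ n → n , refl))
               _≼_ (λ {s} → ≼-refl {s}) (λ {s} {t} {u} → ≼-trans {s} {t} {u}) lower-bound
               Meets (λ {s} {t} {i} → meets-antitone {s} {t} {i}) (state H con h)
      ... | state H′ con′ h′ , (H⊆H′ , reachD) , stable = H′ , h′ , H⊆H′ , con′ , reachD , invariant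
        where
        invariant : ∀ {H″ h″} → H′ ⊆ H″ → Consistent H″ → Reach D H′ h′ h″ →
                    ∀ {g} → Reach P H′ h′ g → Reach P H″ h″ g
        -- Since g lies in the orbit closure of h, some `act m h` replaces it at precision i, and (m
        -- , i) is among the stabilised properties.
        invariant {H″} {h″} ⊆″ con″ reach″ {g} r = reach λ i → answer i (reaching
          (reach-trans {Q = Arbitrary} {S = Arbitrary} (λ _ _ → tt)
            (reach-weaken {D} {Arbitrary} (λ _ → tt) reachD) (reach-⊆ H⊆H′ r)) i)
          where
          answer : ∀ i → (∃ λ m → Fixes H i m × ⊤ × act m h ≈[ i ] g) →
                   ∃ λ x → Fixes H″ i x × P x × act x h″ ≈[ i ] g
          answer i (m , _ , _ , near) with stable {state H″ con″ h″} (⊆″ , reach″) (m , i) meets i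
            where
            meets : Meets (state H′ con′ h′) (m , i)
            meets j with reaching r (j ⊔ i)
            ... | x , fx , px , near′ = x , fixes-mono (m≤m⊔n j i) fx , px ,
              ≈-trans (≈-mono (m≤n⊔m j i) near′) (≈-sym near)
          ... | x , fx , px , near′ = x , fx , px , ≈-trans near′ near

  -- Adding a minimal point to a system.

  fixes-◂ : ∀ {H h f i x} → Fixes H i x →
            (∀ p → p ≤ κ i → (p ≡ 0 → f ≡ true) → act (sub p x) h ≈[ i ] h) →
            Fixes ((h , f) ◂ H) i x
  fixes-◂ fx fh = fixes (beyond fx) λ where
    p p≤ zero    j<i flag → fh p p≤ flag
    p p≤ (suc j) j<i flag → fixed fx p p≤ j (<⇒≤ j<i) flag

  -- Colour focusing, as in the Hales–Jewett theorem; minimality of h turns a line whose points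
  -- have some common effect on h into a line whose points fix h.
  module Lines {H h} (con : Consistent H)
               (minimal : ∀ {b} → Reach Constant H h b → Reach Constant H b h) where

    Line : ℕ → Point → Set
    Line K b = ∀ i → ∃ λ x → Fixes H i x × Variable x ×
                     (∀ p → 1 ≤ p → p ≤ K → act (sub p x) h ≈[ i ] b)

    module Focus {K} (line : Line K h) (i : ℕ) (K<κ : suc K ≤ κ i) where

      -- prefix b a is T_{K+1}(x₀ ⋆ ⋯ ⋆ x_{a-1}) ⋆ x_a ⋆ ⋯ ⋆ x_{b-1}, where the segment x_j is
      -- chosen fine enough to be appended to all prefix j a with a ≤ j.
      prefix : ℕ → ℕ → Choice
      block  : ℕ → ℕ → Choice

      precision : ℕ → ℕ
      precision b = sup (λ a → modulus i (prefix b a)) (suc b)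

      segment : ℕ → Choice
      segment b = proj₁ (line (precision b))

      prefix zero    a = []
      prefix (suc b) a = prefix b a ++ block b a

      block b a with a ≤? b
      ... | yes _ = segment b
      ... | no  _ = sub (suc K) (segment b)

      block-≤ : ∀ {a b} → a ≤ b → block b a ≡ segment b
      block-≤ {a} {b} a≤b with a ≤? b
      ... | yes _   = refl
      ... | no  a≰b = contradiction a≤b a≰b

      block-> : ∀ {a b} → b < a → block b a ≡ sub (suc K) (segment b)
      block-> {a} {b} b<a with a ≤? b
      ... | yes a≤b = contradiction a≤b (<⇒≱ b<a)
      ... | no  _   = refl

      sub-block : ∀ a b → sub (suc K) (block b a) ≡ sub (suc K) (segment b)
      sub-block a b with a ≤? b
      ... | yes _ = refl
      ... | no  _ = sub-sub (suc K) (s≤s z≤n) (segment b)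

      prefix-≥ : ∀ {b a} → b ≤ a → prefix b a ≡ prefix b b
      prefix-≥ {zero}  _   = refl
      prefix-≥ {suc b} b<a = cong₂ _++_
        (trans (prefix-≥ (<⇒≤ b<a)) (sym (prefix-≥ (n≤1+n b))))
        (trans (block-> b<a) (sym (block-> {suc b} {b} ≤-refl)))

      -- The letter K + 1 erases the dependence on a, so all prefixes of length b share one image.
      sub-prefix : ∀ b a → sub (suc K) (prefix b a) ≡ prefix b b
      sub-prefix zero    a = refl
      sub-prefix (suc b) a = trans
        (map-++ (λ d → proj₁ d , fill (suc K) (proj₂ d)) (prefix b a) (block b a))
        (cong₂ _++_ (trans (sub-prefix b a) (sym (prefix-≥ (n≤1+n b))))
                    (trans (sub-block a b) (sym (block-> {suc b} {b} ≤-refl))))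

      modulus≤precision : ∀ b a → modulus i (prefix b a) ≤ precision b
      modulus≤precision b a with ≤-total a b
      ... | inj₁ a≤b = ≤-sup (λ a → modulus i (prefix b a)) (s≤s a≤b)
      ... | inj₂ b≤a rewrite prefix-≥ b≤a = ≤-sup (λ a → modulus i (prefix b a)) {b} ≤-refl

      block-fixes : ∀ b a → Fixes H (modulus i (prefix b a)) (block b a)
      block-fixes b a with a ≤? b
      ... | yes _ = fixes-mono (modulus≤precision b a) (proj₁ (proj₂ (line (precision b))))
      ... | no  _ = fixes-sub (s≤s z≤n) (≤-trans K<κ (κ-mono (i≤modulus i (prefix b a))))
                      (fixes-mono (modulus≤precision b a) (proj₁ (proj₂ (line (precision b)))))

      prefix-fixes : ∀ b a → Fixes H i (prefix b a)
      prefix-fixes zero    a = fixes-[]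
      prefix-fixes (suc b) a = fixes-++ i (prefix b a) (prefix-fixes b a) (block-fixes b a)

      prefix-variable : ∀ {a b} → a < b → Variable (prefix b a)
      prefix-variable {a} {suc b} (s≤s a≤b) = variable-++ʳ {Arbitrary} {prefix b a} tt
        (subst Variable (sym (block-≤ a≤b)) (proj₁ (proj₂ (proj₂ (line (precision b))))))

      -- For p ≤ K the segments from x_a on fix h approximately and are peeled off from the right.
      prefix-near : ∀ {a b p} → a ≤ b → 1 ≤ p → p ≤ K →
                    act (sub p (prefix b a)) h ≈[ i ] act (prefix a a) h
      prefix-near {a} {b} {p} a≤b 1≤p p≤K with m≤n⇒m<n∨m≡n a≤b
      ... | inj₂ refl = subst (λ z → act z h ≈[ i ] act (prefix a a) h)
        (trans (sym (sub-prefix a a)) (trans (sym (sub-sub p (s≤s z≤n) (prefix a a)))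
          (cong (sub p) (sub-prefix a a)))) ≈-refl
      ... | inj₁ (s≤s {n = b′} a≤b′) = ≈-trans
        (append-sub-near i (prefix b′ a) {p} (block b′ a) h (≤-trans p≤K (<⇒≤ K<κ))
          (subst (λ z → act (sub p z) h ≈[ modulus i (prefix b′ a) ] h) (sym (block-≤ a≤b′))
            (≈-mono (modulus≤precision b′ a)
              (proj₂ (proj₂ (proj₂ (line (precision b′)))) p 1≤p p≤K))))
        (prefix-near a≤b′ 1≤p p≤K)

      focus : ∃ λ β → ∃ λ x → Fixes H i x × Variable x ×
              (∀ p → 1 ≤ p → p ≤ suc K → act (sub p x) h ≈[ i ] β)
      -- Two returns to `β` at a < b suffice: `prefix b a` acts like `prefix a a` for p ≤ K and
      -- becomes `prefix b b` for p = K + 1.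
      focus with cluster (λ b → act (prefix b b) h)
      ... | β , lim with lim i
      ... | a , _ , near-a with lim (i ⊔ suc a)
      ... | b , le , near-b = β , prefix b a , prefix-fixes b a , prefix-variable a<b , near
        where
        a<b : a < b
        a<b = ≤-trans (m≤n⊔m i (suc a)) le
        near : ∀ p → 1 ≤ p → p ≤ suc K → act (sub p (prefix b a)) h ≈[ i ] β
        near p 1≤p p≤ with m≤n⇒m<n∨m≡n p≤
        ... | inj₁ (s≤s p≤K) = ≈-trans (prefix-near (<⇒≤ a<b) 1≤p p≤K) near-a
        ... | inj₂ refl = subst (λ z → act z h ≈[ i ] β) (sym (sub-prefix b a))
                            (≈-mono (m≤m⊔n i (suc a)) near-b)

    opaque
      -- Focusing gives a common value for each precision; a cluster point of these values serves
      -- all precisions.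
      focused : ∀ {K} i₀ → suc K ≤ κ i₀ → Line K h → ∃ λ b → Line (suc K) b
      focused {K} i₀ K<κ line = proj₁ (cluster β) , λ i → limit i (proj₂ (cluster β) i)
        where
        focus : ∀ i → ∃ λ β → ∃ λ x → Fixes H (i ⊔ i₀) x × Variable x ×
                (∀ p → 1 ≤ p → p ≤ suc K → act (sub p x) h ≈[ i ⊔ i₀ ] β)
        focus i = Focus.focus line (i ⊔ i₀) (≤-trans K<κ (κ-mono (m≤n⊔m i i₀)))
        β : ℕ → Point
        β i = proj₁ (focus i)
        limit : ∀ i {b} → (∃ λ j → i ≤ j × β j ≈[ i ] b) →
                ∃ λ x → Fixes H i x × Variable x ×
                  (∀ p → 1 ≤ p → p ≤ suc K → act (sub p x) h ≈[ i ] b)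
        limit i (j , i≤j , near) = let _ , x , fx , vx , near′ = focus j in
          x , fixes-mono i≤ fx , vx ,
          λ p 1≤p p≤ → ≈-trans (≈-mono i≤ (near′ p 1≤p p≤)) near
          where
          i≤ : i ≤ j ⊔ i₀
          i≤ = ≤-trans i≤j (m≤m⊔n j i₀)

    lines : ∀ K i₀ → K ≤ κ i₀ → Line K h
    lines zero i₀ _ i with con i
    ... | x , fx , vx = x , fx , vx , λ p 1≤p p≤0 → contradiction (≤-trans 1≤p p≤0) λ ()
    lines (suc K) i₀ K<κ i with focused i₀ K<κ (lines K i₀ (<⇒≤ K<κ))
    ... | b , line = extend (reaching (minimal reachable) (i ⊔ i₀))
      where
      reachable : Reach Constant H h b
      -- At the letter K + 1 the line is a constant word leading from h to b.
      reachable = reach λ j → let x , fx , vx , near = line (j ⊔ i₀) in sub (suc K) x ,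
        fixes-mono (m≤m⊔n j i₀)
          (fixes-sub (s≤s z≤n) (≤-trans K<κ (κ-mono (m≤n⊔m j i₀))) fx) ,
        constant-sub (s≤s z≤n) x , ≈-mono (m≤m⊔n j i₀) (near (suc K) (s≤s z≤n) ≤-refl)
      extend : (∃ λ z → Fixes H (i ⊔ i₀) z × Constant z × act z b ≈[ i ⊔ i₀ ] h) →
               ∃ λ x → Fixes H i x × Variable x ×
                 (∀ p → 1 ≤ p → p ≤ suc K → act (sub p x) h ≈[ i ] h)
      -- Being constant, z is the same under every substitution, so it brings all points of the line
      -- from b back to h.
      extend (z , fz , cz , near-z) with line (modulus (i ⊔ i₀) z)
      ... | x , fx , vx , near = z ++ x ,
        fixes-mono (m≤m⊔n i i₀) (fixes-++ (i ⊔ i₀) z fz fx) ,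
        variable-++ʳ {Constant} cz vx ,
        λ p 1≤p p≤ → ≈-mono (m≤m⊔n i i₀) (≈-trans
          (append-sub-near (i ⊔ i₀) z x h (≤-trans p≤ (≤-trans K<κ (κ-mono (m≤n⊔m i i₀))))
            (near p 1≤p p≤))
          (subst (λ y → act y b ≈[ i ⊔ i₀ ] h) (sym (sub-constant cz)) near-z))

    ◂-consistent : Consistent ((h , false) ◂ H)
    -- K = `κ i` covers every positive letter tested at stage i; the flag `false` exempts the letter
    -- 0.
    ◂-consistent i with lines (κ i) i ≤-refl i
    ... | x , fx , vx , near = x , fixes-◂ fx (λ where
      zero    p≤ flag → contradiction (flag refl) λ ()
      (suc p) p≤ flag → near (suc p) (s≤s z≤n) p≤) , vx

  -- Absorbed, stabilised and recurrent points.

  opaque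
    -- The empty word takes h to itself, so by stability every point reached from h by constant
    -- words leads back to h.
    absorb : ∀ {H} → Consistent H → ∀ a → ∃ λ H′ → ∃ λ h →
             H ⊆ H′ × Reach Constant H a h × Consistent ((h , false) ◂ H′)
    absorb con a with Descent.descend Constant Constant [] constant-++ constant-++ a con
    ... | H′ , h , H⊆H′ , con′ , ah , stable = H′ , h , H⊆H′ , ah ,
      Lines.◂-consistent con′ (λ r → stable ⊆-refl con′ r (reach-refl []))

  opaque
    -- A descent in which only the empty word may move the point, so that the system alone changes.
    stabilise : ∀ P {H} → Consistent H → ∀ a → ∃ λ H′ → H ⊆ H′ × Consistent H′ ×
      (∀ {H″} → H′ ⊆ H″ → Consistent H″ → ∀ {g} → Reach P H′ a g → Reach P H″ a g)
    stabilise P con a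
      with Descent.descend (_≡ []) P refl (λ { refl refl → refl })
             (λ { {x} p refl → subst P (sym (++-identityʳ x)) p }) a con
    ... | H′ , a′ , H⊆H′ , con′ , aa′ , stable = H′ , H⊆H′ , con′ ,
      λ H′⊆H″ con″ r → move ≈-sym (stable H′⊆H″ con″ (reach-refl refl) (move (λ p → p) r))
      where
      same : ∀ i → a ≈[ i ] a′
      same i with reaching aa′ i
      ... | .[] , _ , refl , near = ≈-trans (≈-sym (act-[] a)) near
      -- The descent returns a point agreeing with a at every precision, not a itself.
      move : ∀ {b c H g} → (∀ {i} → a ≈[ i ] a′ → b ≈[ i ] c) → Reach P H b g → Reach P H c g
      move eq r = reach λ i → let x , fx , px , near = reaching r i in
        x , fx , px ,
        ≈-trans (≈-sym (act-continuous i x (eq (same (modulusOfContinuity i x))))) near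

  -- Minimality of the points reachable from h₁ gives a point h that is reachable from itself even
  -- within the smaller semigroup of those words x for which all T_p(x) fix h.
  recurrent : ∀ {H} → Consistent H → ∀ f → ∃ λ H′ → ∃ λ h → H ⊆ H′ ×
              Consistent ((h , true) ◂ H′) × Reach Variable H f h
  recurrent {H} con f
    with Descent.descend Arbitrary Variable tt (λ _ _ → tt) (variable-++ˡ {Arbitrary}) f con
  -- The variable word comes before the absorption by constant words, so that h is reached from h₁
  -- by variable words.
  ... | H₁ , h₁ , H⊆H₁ , con₁ , reach₁ , stable with reach-variable con₁ h₁
  ... | h₂ , reach₂ with absorb con₁ h₂
  ... | H₃ , h , H₁⊆H₃ , reach₃ , con₃ =
    (h , false) ◂ H₃ , h , ⊆-trans H⊆H₁ H₁⊆ , con₄ ,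
    reach-trans (variable-++ˡ {Arbitrary}) reach₁ (reach-⊆ H⊆H₁ reach-h)
    where
    H₁⊆ : H₁ ⊆ (h , false) ◂ H₃
    H₁⊆ = ⊆-trans H₁⊆H₃ ⊆-◂
    reach-h : Reach Variable H₁ h₁ h
    reach-h = reach-trans (variable-++ʳ {Constant}) reach₂ reach₃
    con₄ : Consistent ((h , true) ◂ (h , false) ◂ H₃)
    con₄ i with reaching
      (stable H₁⊆ con₃ (reach-weaken {Variable} {Arbitrary} (λ _ → tt) reach-h) reach-h) (suc i)
    ... | x , fx , vx , near = x , fixes-◂ (fixes-mono (n≤1+n i) fx) (λ where
      zero    p≤ _ → subst (λ y → act y h ≈[ i ] h) (sym (sub-zero x)) (≈-mono (n≤1+n i) near)
      (suc p) p≤ _ → ≈-mono (n≤1+n i)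
        (fixed fx (suc p) (≤-trans p≤ (κ-mono (n≤1+n i))) 0 (s≤s z≤n) λ ())) , vx

  -- Generic words.

  -- In terms of ultrafilters q on constant and v on variable words, f = q·c and h = v·c, where
  -- v = v·v = q·v = v·q, q = q·q and T_p(v) = q.
  record Generic (c f h : Point) (i : ℕ) (d : Choice) : Set where
    field
      beyond-d   : Beyond i d
      variable-d : Variable d
      sub-c      : ∀ {p} → 1 ≤ p → p ≤ κ i → act (sub p d) c ≈[ i ] f
      sub-f      : ∀ {p} → 1 ≤ p → p ≤ κ i → act (sub p d) f ≈[ i ] f
      sub-h      : ∀ {p} → 1 ≤ p → p ≤ κ i → act (sub p d) h ≈[ i ] h
      act-c      : act d c ≈[ i ] h
      act-f      : act d f ≈[ i ] h
      act-h      : act d h ≈[ i ] h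
  open Generic public

  -- Constant points are fixed by every word, so this system plays the part of the empty one.
  constant-point-consistent : ∀ v → Consistent (λ _ → (λ _ → v) , false)
  constant-point-consistent v i = (i , 0) ∷ [] ,
    fixes ([-] , (≤-refl , z≤n) ∷ [])
      (λ p _ _ _ _ → agree λ n _ → act-apply (sub p ((i , 0) ∷ [])) (λ _ → v) (word n)) ,
    here refl

  opaque
    generic : ∀ c → ∃ λ f → ∃ λ h → ∀ i → ∃ λ d → Generic c f h i d
    -- Stabilising c and f before moving on keeps the reaches from c to f and from f to h valid in
    -- the final system.
    generic c with stabilise Constant (constant-point-consistent (c [])) c
    ... | H₁ , _ , con₁ , stable₁ with absorb con₁ c
    ... | H₂ , f , H₁⊆H₂ , c⇝f , con₂ with stabilise Variable con₂ f
    ... | H₃ , H₂⊆H₃ , con₃ , stable₃ with recurrent con₃ f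
    ... | H₄ , h , H₃⊆H₄ , con₄ , f⇝h = f , h , line
      where
      H : System
      H = (h , true) ◂ H₄
      H₃⊆H : H₃ ⊆ H
      H₃⊆H = ⊆-trans H₃⊆H₄ ⊆-◂
      f∈H : ∃ λ j → H j ≡ (f , false)
      f∈H = ⊆-trans H₂⊆H₃ H₃⊆H 0
      m : ℕ
      m = proj₁ f∈H
      m≡ : proj₁ (H m) ≡ f
      m≡ = cong proj₁ (proj₂ f∈H)
      c⇝f′ : Reach Constant H c f
      c⇝f′ = stable₁ (⊆-trans H₁⊆H₂ (⊆-trans ⊆-◂ (⊆-trans H₂⊆H₃ H₃⊆H))) con₄ c⇝f
      f⇝h′ : Reach Variable H f h
      f⇝h′ = stable₃ H₃⊆H con₄ f⇝h
      module _ (i : ℕ) where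
        i′ : ℕ
        i′ = i ⊔ suc m
        i≤ : i ≤ i′
        i≤ = m≤m⊔n i (suc m)
        m< : m < i′
        m< = m≤n⊔m i (suc m)
        κ≤ : ∀ {p} → p ≤ κ i → p ≤ κ i′
        κ≤ p≤ = ≤-trans p≤ (κ-mono i≤)
        fixes-f : ∀ {x j} → m < j → Fixes H j x → ∀ p → 1 ≤ p → p ≤ κ j →
                  act (sub p x) f ≈[ j ] f
        fixes-f {x} {j} m<j fx p 1≤p p≤ = subst (λ a → act (sub p x) a ≈[ j ] a) m≡
          (fixed fx p p≤ m m<j λ { refl → contradiction 1≤p λ () })
        line : ∃ λ d → Generic c f h i d
        -- The word x ++ z takes c through f to h. Since z and `sub p x` with p ≥ 1 fix f, the other
        -- equations follow from the entries f and h of `H`.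
        line with reaching f⇝h′ i′
        ... | x , fx , vx , near-x with reaching c⇝f′ (modulus i′ x)
        ... | z , fz , cz , near-z = x ++ z , record
          { beyond-d   = beyond (fixes-mono i≤ fd)
          ; variable-d = variable-++ˡ {Constant} vx cz
          ; sub-c = λ {p} 1≤p p≤ → ≈-mono i≤ (≈-trans
              (append-sub-near i′ x z c (κ≤ p≤)
                (subst (λ y → act y c ≈[ modulus i′ x ] f) (sym (sub-constant cz)) near-z))
              (fixes-f m< fx p 1≤p (κ≤ p≤)))
          ; sub-f = λ {p} 1≤p p≤ → ≈-mono i≤ (fixes-f m< fd p 1≤p (κ≤ p≤))
          ; sub-h = λ {p} 1≤p p≤ → ≈-mono i≤ (fixed fd p (κ≤ p≤) 0 0<i′ λ _ → refl)
          ; act-c = ≈-mono i≤ (≈-trans (append-near i′ x z c near-z) near-x)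
          ; act-f = ≈-mono i≤ (≈-trans (append-near i′ x z f near-f) near-x)
          ; act-h = ≈-mono i≤ (subst (λ y → act y h ≈[ i′ ] h) (sub-zero (x ++ z))
              (fixed fd 0 z≤n 0 0<i′ λ _ → refl))
          }
          where
          fd : Fixes H i′ (x ++ z)
          fd = fixes-++ i′ x fx fz
          0<i′ : 0 < i′
          0<i′ = ≤-trans (s≤s z≤n) m<
          near-f : act z f ≈[ modulus i′ x ] f
          near-f = subst (λ a → act z a ≈[ modulus i′ x ] a) m≡
            (fixes-constant fz cz m (≤-trans m< (i≤modulus i′ x)))

  -- Construction of a homogeneous sequence.

  record Homogeneous (c : Point) (d : ℕ → Choice) : Set where
    field
      d-beyond    : ∀ n → Beyond n (d n)
      d-variable  : ∀ n → Variable (d n)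
      d-separated : ∀ n → All (λ a → All (λ b → proj₁ a < proj₁ b) (d (suc n))) (d n)
      colour-E colour-EV : Fin R
      E-colour    : ∀ {ds} → ¬ (ds ≡ []) → IncIdx ds →
                    All (λ e → 1 ≤ proj₂ e × proj₂ e ≤ κ (proj₁ e)) ds →
                    c (expand d ds) ≡ colour-E
      EV-colour   : ∀ {ds} → IncIdx ds → All (λ e → proj₂ e ≤ κ (proj₁ e)) ds →
                    Variable ds → c (expand d ds) ≡ colour-EV

  homogeneous : ∀ c → ∃ (Homogeneous c)
  homogeneous c with generic c
  ... | f , h , line = d , record
    { d-beyond    = λ n → let inc , ok = beyond-d (gen n) in
                          inc , All.map (λ (N≤ , l) → ≤-trans (n≤N n) N≤ , l) ok
    ; d-variable  = λ n → variable-d (gen n)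
    ; d-separated = λ n → All.map (λ lt → All.map (λ (N≤ , _) → ≤-trans lt N≤)
                                            (proj₂ (beyond-d (gen (suc n)))))
                            (<-end (d n) (end≤N n))
    ; colour-E    = f []
    ; colour-EV   = h []
    ; E-colour    = E-colour′
    ; EV-colour   = λ { {e ∷ ds} inc ok var → EV-word inc ok var [] (index[]<N (proj₁ e)) }
    }
    where
    N : ℕ → ℕ
    d : ℕ → Choice
    room : ℕ → ℕ → ℕ
    -- Every word of index below `N n`, extended by any `sub p (d n)` with p ≤ `κ n`, must have
    -- index below `N (suc n)`.
    room n j = sup (λ p → suc (index (word j ++ sub p (d n)))) (suc (κ n))
    reserve : ℕ → ℕ
    reserve n = sup (room n) (N n)
    -- Reading starts at the empty word.
    N zero    = suc (index [])
    N (suc n) = (suc n ⊔ end (d n)) ⊔ (N n ⊔ reserve n)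
    d n = proj₁ (line (N n))
    gen : ∀ n → Generic c f h (N n) (d n)
    gen n = proj₂ (line (N n))

    n≤N : ∀ n → n ≤ N n
    n≤N zero    = z≤n
    n≤N (suc n) = m≤n⇒m≤n⊔o _ (m≤m⊔n (suc n) (end (d n)))

    end≤N : ∀ n → end (d n) ≤ N (suc n)
    end≤N n = m≤n⇒m≤n⊔o _ (m≤n⊔m (suc n) (end (d n)))

    N≤N : ∀ n → N n ≤ N (suc n)
    N≤N n = m≤n⇒m≤o⊔n (suc n ⊔ end (d n)) (m≤m⊔n (N n) (reserve n))

    N-mono : ∀ {m n} → m ≤ n → N m ≤ N n
    N-mono {m} {zero}  z≤n = ≤-refl
    N-mono {m} {suc n} m≤n with m≤n⇒m<n∨m≡n m≤n
    ... | inj₂ refl      = ≤-refl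
    ... | inj₁ (s≤s m≤n) = ≤-trans (N-mono m≤n) (N≤N n)

    index[]<N : ∀ n → index [] < N n
    index[]<N n = N-mono {0} {n} z≤n

    index<N : ∀ n {p s} → p ≤ κ n → index s < N n → index (s ++ sub p (d n)) < N (suc n)
    index<N n {p} {s} p≤ lt = m≤n⇒m≤o⊔n (suc n ⊔ end (d n)) (m≤n⇒m≤o⊔n (N n) (≤-trans
      (subst (λ t → suc (index (t ++ sub p (d n))) ≤ room n (index s)) (word-index s)
        (≤-sup (λ p → suc (index (word (index s) ++ sub p (d n)))) (s≤s p≤)))
      (≤-sup (room n) lt)))

    evaluate : ∀ n {x a b} s → index s < N n → act x a ≈[ N n ] b → a (s ++ x) ≡ b s
    evaluate n {x} {a} s lt near = trans (sym (act-apply x a s)) (≈-at s lt near)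

    κ≤ : ∀ n {p} → p ≤ κ n → p ≤ κ (N n)
    κ≤ n p≤ = ≤-trans p≤ (κ-mono (n≤N n))

    reassociate : ∀ {a : Point} {v} s x ds → a ((s ++ x) ++ expand d ds) ≡ v →
                  a (s ++ (x ++ expand d ds)) ≡ v
    reassociate {a} s x ds eq = trans (cong a (sym (++-assoc s x (expand d ds)))) eq

    -- Reading a word from the left, the part s already read is recorded by the value of f or h
    -- at s, which letters T_p(dₙ) leave unchanged and the first dₙ moves from f to h.
    E-word : ∀ {n p ds} → IncIdx ((n , p) ∷ ds) →
             All (λ e → 1 ≤ proj₂ e × proj₂ e ≤ κ (proj₁ e)) ((n , p) ∷ ds) →
             ∀ s → index s < N n → c (s ++ expand d ((n , p) ∷ ds)) ≡ f s
    E-word {n} {p} {[]} _ ((1≤p , p≤) ∷ []) s lt =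
      trans (cong (λ x → c (s ++ x)) (++-identityʳ (sub p (d n))))
            (evaluate n s lt (sub-c (gen n) 1≤p (κ≤ n p≤)))
    E-word {n} {p} {ds@(_ ∷ _)} (n<n′ ∷ inc) ((1≤p , p≤) ∷ ok) s lt =
      reassociate {c} s (sub p (d n)) ds (trans
        (E-word inc ok (s ++ sub p (d n)) (≤-trans (index<N n p≤ lt) (N-mono n<n′)))
        (evaluate n s lt (sub-f (gen n) 1≤p (κ≤ n p≤))))

    E-colour′ : ∀ {ds} → ¬ (ds ≡ []) → IncIdx ds →
                All (λ e → 1 ≤ proj₂ e × proj₂ e ≤ κ (proj₁ e)) ds → c (expand d ds) ≡ f []
    E-colour′ {[]}     ne _   _  = contradiction refl ne
    E-colour′ {e ∷ ds} _  inc ok = E-word inc ok [] (index[]<N (proj₁ e))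

    EV-word : ∀ {n p ds} → IncIdx ((n , p) ∷ ds) →
              All (λ e → proj₂ e ≤ κ (proj₁ e)) ((n , p) ∷ ds) → Variable ((n , p) ∷ ds) →
              ∀ s → index s < N n → c (s ++ expand d ((n , p) ∷ ds)) ≡ h s
    EV-word {n} {suc p} {ds@(_ ∷ _)} (n<n′ ∷ inc) (p≤ ∷ ok) (there var) s lt =
      reassociate {c} s (sub (suc p) (d n)) ds (trans
        (EV-word inc ok var (s ++ sub (suc p) (d n)) (≤-trans (index<N n p≤ lt) (N-mono n<n′)))
        (evaluate n s lt (sub-h (gen n) (s≤s z≤n) (κ≤ n p≤))))
    EV-word {n} {zero} {[]} _ _ _ s lt =
      trans (cong (λ x → c (s ++ x)) (trans (++-identityʳ (sub 0 (d n))) (sub-zero (d n))))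
            (evaluate n s lt (act-c (gen n)))
    -- If the variable occurs again, the rest is recorded by h, which `d n` fixes; otherwise by f,
    -- which `d n` takes to h.
    EV-word {n} {zero} {ds@(_ ∷ _)} (n<n′ ∷ inc) (p≤ ∷ ok) _ s lt with lem {Variable ds}
    ... | yes var = reassociate {c} s (sub 0 (d n)) ds (trans
        (EV-word inc ok var (s ++ sub 0 (d n)) (≤-trans (index<N n p≤ lt) (N-mono n<n′)))
        (trans (cong (λ x → h (s ++ x)) (sub-zero (d n))) (evaluate n s lt (act-h (gen n)))))
    ... | no con = reassociate {c} s (sub 0 (d n)) ds (trans
        (E-word inc (All.zip (All.map (λ ne → n≢0⇒n>0 ne) (All.¬Any⇒All¬ ds con) , ok))
          (s ++ sub 0 (d n)) (≤-trans (index<N n p≤ lt) (N-mono n<n′)))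
        (trans (cong (λ x → f (s ++ x)) (sub-zero (d n))) (evaluate n s lt (act-f (gen n)))))

-- Evaluation of choice lists as words.

positions-T : ∀ k p x → map proj₁ (T k p x) ≡ map proj₁ x
positions-T k zero    x       = refl
positions-T k (suc p) []      = refl
positions-T k (suc p) (e ∷ x) = cong (proj₁ e ∷_) (positions-T k (suc p) x)

all-positions : ∀ {P : ℕ → Set} {x y : Word} → map proj₁ x ≡ map proj₁ y →
                All (λ e → P (proj₁ e)) x → All (λ e → P (proj₁ e)) y
all-positions {P} eq ps = All.map⁻ (subst (All P) eq (All.map⁺ ps))

module WordTransfer (k : ℕ → ℕ) where

  <ʷ-T : ∀ {x y} p q → x <ʷ y → T k p x <ʷ T k q y
  <ʷ-T {x} {y} p q lt = all-positions {λ m → All (λ e → m < proj₁ e) (T k q y)}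
    (sym (positions-T k p x))
    (All.map (all-positions {λ m → _ < m} (sym (positions-T k q y))) lt)

  <ʷ-++ : ∀ {x y z} → x <ʷ y → x <ʷ z → x <ʷ (y ++ z)
  <ʷ-++ []       []       = []
  <ʷ-++ (p ∷ ps) (q ∷ qs) = All.++⁺ p q ∷ <ʷ-++ ps qs

  <ʷ-[] : ∀ x → x <ʷ []
  <ʷ-[] []      = []
  <ʷ-[] (e ∷ x) = [] ∷ <ʷ-[] x

  <ʷ-trans : ∀ {x y z} → ¬ (y ≡ []) → x <ʷ y → y <ʷ z → x <ʷ z
  <ʷ-trans {y = []}    ne _  _        = contradiction refl ne
  <ʷ-trans {y = e ∷ y} _  lt (e< ∷ _) = All.map (λ { (lt ∷ _) → All.map (<-trans lt) e< }) lt

  T-T : ∀ p q x → T k p (T k q x) ≡ T k (fill p q) x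
  T-T zero    zero    x       = refl
  T-T zero    (suc q) x       = refl
  T-T (suc p) zero    x       = refl
  T-T (suc p) (suc q) []      = refl
  T-T (suc p) (suc q) (e ∷ x) =
    cong₂ _∷_ (cong (proj₁ e ,_) (symbol (proj₂ e))) (T-T (suc p) (suc q) x)
    where
    symbol : ∀ a → Tsym k (suc p) (proj₁ e) (Tsym k (suc q) (proj₁ e) a) ≡
                   Tsym k (suc q) (proj₁ e) a
    symbol (α i) = refl
    symbol υ with suc q ≤ᵇ k (proj₁ e)
    ... | true  = refl
    ... | false = refl

  T-++ : ∀ p x y → T k p (x ++ y) ≡ T k p x ++ T k p y
  T-++ zero    x y = refl
  T-++ (suc p) x y = map-++ _ x y

  T-eval : ∀ w p ds → T k p (evalChoice k w ds) ≡ evalChoice k w (sub p ds)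
  T-eval w zero    []             = refl
  T-eval w (suc p) []             = refl
  T-eval w p       ((n , q) ∷ ds) =
    trans (T-++ p (T k q (w n)) _) (cong₂ _++_ (T-T p q (w n)) (T-eval w p ds))

  -- This carries homogeneity over from choice lists to the words built from an extraction.
  eval-expand : ∀ w d ds →
                evalChoice k (λ n → evalChoice k w (d n)) ds ≡ evalChoice k w (expand d ds)
  eval-expand w d []             = refl
  eval-expand w d ((n , p) ∷ ds) = trans
    (cong₂ _++_ (T-eval w p (d n)) (eval-expand w d ds))
    (sym (concatMap-++ (λ e → T k (proj₂ e) (w (proj₁ e))) (sub p (d n)) (expand d ds)))

  T-nonempty : ∀ p {x} → ¬ (x ≡ []) → ¬ (T k p x ≡ [])
  T-nonempty zero            ne eq = ne eq
  T-nonempty (suc p) {[]}    ne _  = ne refl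
  T-nonempty (suc p) {_ ∷ _} _  ()

  T-sorted : ∀ p {x} → Sorted x → Sorted (T k p x)
  T-sorted zero    sorted = sorted
  T-sorted (suc p) sorted = Linked.map⁺ sorted

  T-letters : ∀ {p x} → (∀ n → 1 ≤ n → 1 ≤ k n) → 1 ≤ p → All (VarLetterOK k) x →
              All (LetterOK k) (T k p x)
  T-letters {suc p} 1≤k 1≤p ok = All.map⁺ (All.map (λ {e} → letter {e}) ok)
    where
    letter : ∀ {e} → VarLetterOK k e → LetterOK k (proj₁ e , Tsym k (suc p) (proj₁ e) (proj₂ e))
    letter {n , α i} ok = ok
    letter {n , υ} 1≤n with suc p ≤ᵇ k n in eq
    ... | true  = 1≤n , s≤s z≤n , ≤ᵇ⇒≤ (suc p) (k n) (subst IsTrue (sym eq) tt)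
    -- Here the last letter `α (k n)` is inserted, which is legal as `k n` is positive.
    ... | false = 1≤n , 1≤k n 1≤n , ≤-refl

  letter⇒varLetter : ∀ {e} → LetterOK k e → VarLetterOK k e
  letter⇒varLetter {n , α i} ok = ok

  T-valid : ∀ p {x} → (∀ n → 1 ≤ n → 1 ≤ k n) → All (VarLetterOK k) x →
            All (VarLetterOK k) (T k p x)
  T-valid zero    1≤k ok = ok
  T-valid (suc p) 1≤k ok = All.map letter⇒varLetter (T-letters 1≤k (s≤s z≤n) ok)

  module Sequence (1≤k : ∀ n → 1 ≤ n → 1 ≤ k n) {w : ℕ → Word} (seq : InfSeq k w) where

    eval : Choice → Word
    eval = evalChoice k w

    word-< : ∀ {m n} → m < n → w m <ʷ w n
    word-< {m} {suc n} (s≤s m≤n) with m≤n⇒m<n∨m≡n m≤n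
    ... | inj₂ refl = proj₂ seq m
    ... | inj₁ m<n  = <ʷ-trans (proj₁ (proj₁ seq n)) (word-< m<n) (proj₂ seq n)

    word-<-eval : ∀ {n ds} p → All (λ e → n < proj₁ e) ds → T k p (w n) <ʷ eval ds
    word-<-eval {n} p []         = <ʷ-[] (T k p (w n))
    word-<-eval {n} {e ∷ _} p (lt ∷ lts) = <ʷ-++ (<ʷ-T p (proj₂ e) (word-< lt)) (word-<-eval p lts)

    eval-< : ∀ {ds es} → All (λ a → All (λ b → proj₁ a < proj₁ b) es) ds → eval ds <ʷ eval es
    eval-< []         = []
    eval-< {e ∷ _} (lt ∷ lts) = All.++⁺ (word-<-eval (proj₂ e) lt) (eval-< lts)

    eval-sorted : ∀ {ds} → IncIdx ds → Sorted (eval ds)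
    eval-sorted {[]}     inc = []
    eval-sorted {e ∷ ds} inc = linked-++
      (T-sorted (proj₂ e) (proj₁ (proj₂ (proj₁ seq (proj₁ e)))))
      (eval-sorted (Linked.tail inc))
      (word-<-eval (proj₂ e) (head-< inc))
      where
      head-< : ∀ {e ds} → IncIdx (e ∷ ds) → All (λ e′ → proj₁ e < proj₁ e′) ds
      head-< [-]        = []
      head-< {e} (lt ∷ inc) = Linked.Linked⇒All <-trans {v = e} lt inc

    eval-nonempty : ∀ {ds} → ¬ (ds ≡ []) → ¬ (eval ds ≡ [])
    eval-nonempty {[]} ne _ = ne refl
    eval-nonempty {(n , p) ∷ ds} _ eq =
      T-nonempty p (proj₁ (proj₁ seq n)) (++-conicalˡ (T k p (w n)) (eval ds) eq)

    eval-valid : ∀ ds → All (VarLetterOK k) (eval ds)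
    eval-valid []             = []
    eval-valid ((n , p) ∷ ds) =
      All.++⁺ (T-valid p 1≤k (proj₁ (proj₂ (proj₂ (proj₁ seq n))))) (eval-valid ds)

    eval-letters : ∀ {ds} → Constant ds → All (LetterOK k) (eval ds)
    eval-letters []           = []
    eval-letters (1≤p ∷ 1≤ps) =
      All.++⁺ (T-letters 1≤k 1≤p (proj₁ (proj₂ (proj₂ (proj₁ seq _))))) (eval-letters 1≤ps)

    eval-variable : ∀ {ds} → Variable ds → Any (λ e → proj₂ e ≡ υ) (eval ds)
    eval-variable {(n , _) ∷ ds} (here refl) = Any.++⁺ˡ (proj₂ (proj₂ (proj₂ (proj₁ seq n))))
    eval-variable {(n , p) ∷ ds} (there var) = Any.++⁺ʳ (T k p (w n)) (eval-variable var)

    variable-nonempty : ∀ {ds} → Variable ds → ¬ (ds ≡ [])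
    variable-nonempty () refl

    eval-varWord : ∀ {ds} → IncIdx ds → Variable ds → IsVarWord k (eval ds)
    eval-varWord {ds} inc var = eval-nonempty (variable-nonempty var) , eval-sorted inc ,
                           eval-valid ds , eval-variable var

    eval-word : ∀ {ds} → ¬ (ds ≡ []) → IncIdx ds → Constant ds → IsWord k (eval ds)
    eval-word ne inc con = eval-nonempty ne , eval-sorted inc , eval-letters con

  -- Disjointness of the two kinds of words lets a single colouring encode both covers.
  word-not-varWord : ∀ {v} → IsWord k v → ¬ IsVarWord k v
  word-not-varWord (_ , _ , ok) (_ , _ , _ , var) = conflict ok var
    where
    conflict : ∀ {v} → All (LetterOK k) v → ¬ Any (λ e → proj₂ e ≡ υ) v
    conflict (() ∷ _) (here refl)
    conflict (_ ∷ ok) (there var) = conflict ok var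

-- Both covers in one colouring.

theorem1p4 : ExcludedMiddle 0ℓ →
    (k : ℕ → ℕ) → (∀ n → 1 ≤ n → 1 ≤ k n) → (∀ n → 1 ≤ n → k n ≤ k (suc n)) →
    (w : ℕ → Word) → InfSeq k w →
    (r s : ℕ) → (A : Fin r → Word → Set) → (C : Fin s → Word → Set) →
    (∀ v → IsVarWord k v → ∃ λ i → A i v) →
    (∀ v → IsWord k v → ∃ λ j → C j v) →
    ∃ λ u → Extraction k u w × ∃ λ i₀ → ∃ λ j₀ →
    (∀ v → InEV k u v → A i₀ v) × (∀ v → InE k u v → C j₀ v)
theorem1p4 lem k 1≤k k-mono w seq r s A C coverA coverC =
  u , (u-seq , u-EV) , i₀ , j₀ , EV-mono , E-mono
  where
  open WordTransfer k
  -- Terms are indexed from 0, hence the shift.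
  κ : ℕ → ℕ
  κ n = k (suc n)
  κ-mono : ∀ {m n} → m ≤ n → κ m ≤ κ n
  κ-mono {m} {zero}  z≤n = ≤-refl
  κ-mono {m} {suc n} m≤n with m≤n⇒m<n∨m≡n m≤n
  ... | inj₂ refl      = ≤-refl
  ... | inj₁ (s≤s m≤n) = ≤-trans (κ-mono m≤n) (k-mono (suc n) (s≤s z≤n))

  1≤κ : ∀ n → 1 ≤ κ n
  1≤κ n = 1≤k (suc n) (s≤s z≤n)

  open Dynamics lem κ 1≤κ κ-mono (r + s)
  open Sequence 1≤k seq

  colour : Word → Fin (r + s)
  colour v with lem {IsVarWord k v}
  ... | yes p = proj₁ (coverA v p) ↑ˡ s
  ... | no _ with lem {IsWord k v}
  ...   | yes q = r ↑ʳ proj₁ (coverC v q)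
  -- A default for lists of neither kind; the variable word `w 0` provides a colour.
  ...   | no _  = proj₁ (coverA (w 0) (proj₁ seq 0)) ↑ˡ s

  colour-varWord : ∀ {v} → IsVarWord k v → ∃ λ i → A i v × colour v ≡ i ↑ˡ s
  colour-varWord {v} p with lem {IsVarWord k v}
  ... | yes q = proj₁ (coverA v q) , proj₂ (coverA v q) , refl
  ... | no ¬p = contradiction p ¬p

  colour-word : ∀ {v} → IsWord k v → ∃ λ j → C j v × colour v ≡ r ↑ʳ j
  colour-word {v} q with lem {IsVarWord k v}
  ... | yes p = contradiction p (word-not-varWord q)
  ... | no _ with lem {IsWord k v}
  ...   | yes q′ = proj₁ (coverC v q′) , proj₂ (coverC v q′) , refl
  ...   | no ¬q  = contradiction q ¬q

  d : ℕ → Choice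
  d = proj₁ (homogeneous (λ x → colour (eval x)))
  d-homogeneous : Homogeneous (λ x → colour (eval x)) d
  d-homogeneous = proj₂ (homogeneous (λ x → colour (eval x)))
  open Homogeneous d-homogeneous

  u : ℕ → Word
  u n = eval (d n)

  u-varWord : ∀ n → IsVarWord k (u n)
  u-varWord n = eval-varWord (proj₁ (d-beyond n)) (d-variable n)
  u-< : ∀ n → u n <ʷ u (suc n)
  u-< n = eval-< (d-separated n)
  u-EV : ∀ n → InEV k w (u n)
  u-EV n = d n , (variable-nonempty (d-variable n) , proj₁ (d-beyond n) ,
                  All.map proj₂ (proj₂ (d-beyond n)) , d-variable n) , refl

  u-seq : InfSeq k u
  u-seq = u-varWord , u-<
  module U = Sequence 1≤k u-seq

  varWord : ∀ ds → ValidEV k ds → ∃ λ i → A i (U.eval ds) × i ↑ˡ s ≡ colour-EV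
  varWord ds (_ , inc , ok , var) =
    let i , Ai , eq = colour-varWord (U.eval-varWord inc var) in
    i , Ai , trans (sym eq) (trans (cong colour (eval-expand w d ds)) (EV-colour inc ok var))

  constWord : ∀ ds → ValidE k ds → ∃ λ j → C j (U.eval ds) × r ↑ʳ j ≡ colour-E
  constWord ds (ne , inc , ok) =
    let j , Cj , eq = colour-word (U.eval-word ne inc (All.map proj₁ ok)) in
    j , Cj , trans (sym eq) (trans (cong colour (eval-expand w d ds)) (E-colour ne inc ok))

  -- One-term choices, from whose colours `i₀` and `j₀` are read off.
  EV₀ : ValidEV k ((0 , 0) ∷ [])
  EV₀ = (λ ()) , [-] , z≤n ∷ [] , here refl

  E₀ : ValidE k ((0 , 1) ∷ [])
  E₀ = (λ ()) , [-] , (≤-refl , 1≤k 1 ≤-refl) ∷ []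

  i₀ : Fin r
  i₀ = proj₁ (varWord _ EV₀)
  j₀ : Fin s
  j₀ = proj₁ (constWord _ E₀)

  EV-mono : ∀ v → InEV k u v → A i₀ v
  EV-mono v (ds , valid , refl) =
    let i , Ai , eq = varWord ds valid in
    subst (λ i → A i v) (↑ˡ-injective s i i₀ (trans eq (sym (proj₂ (proj₂ (varWord _ EV₀)))))) Ai

  E-mono : ∀ v → InE k u v → C j₀ v
  E-mono v (ds , valid , refl) =
    let j , Cj , eq = constWord ds valid in
    subst (λ j → C j v) (↑ʳ-injective r j j₀ (trans eq (sym (proj₂ (proj₂ (constWord _ E₀)))))) Cj
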